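{- Let $a,b\ge 1$ be integers and let $K_{a,b}$ be the complete bipartite graph. A nonnegative integer $p$ is the period $p(\sigma)$ of some position $\sigma$ of the parallel chip-firing game on $K_{a,b}$ if and only if $$p\in \{\,i : 1\le i\le \min(a,b)\,\}\cup\{\,2i : 1\le i\le \min(a,b)\,\}.$$
   Context: Parallel chip-firing game on a finite simple connected graph $G$: a position $\sigma$ assigns a nonnegative integer $\sigma(v)$ (number of chips) to each vertex $v$. At each step, every vertex $v$ with $\sigma(v)\ge \deg(v)$ (a firing vertex) simultaneously sends one chip to each neighbor; other vertices do not fire. Thus, writing $U$ for the step operator and $\Phi_\sigma(v)$ for the number of neighbors $w$ of $v$ with $\sigma(w)\ge\deg(w)$, $U\sigma(v)=\sigma(v)+\Phi_\sigma(v)$ if $\sigma(v)\le \deg(v)-1$ and $U\sigma(v)=\sigma(v)+\Phi_\sigma(v)-\deg(v)$ if $\sigma(v)\ge\deg(v)$. $U^0\sigma=\sigma$, $U^m\sigma=U(U^{m-1}\sigma)$. The period $p(\sigma)$ is the least positive integer $p$ such that $U^{t}\sigma=U^{t+p}\sigma$ for all sufficiently large $t$. -}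

module Defs where

open import Data.Nat using (ℕ; zero; suc; _+_; _∸_; _≤_; _<_; _≤ᵇ_; _<ᵇ_)
open import Data.Bool using (Bool; true; false; if_then_else_; _∧_; not; _xor_)
open import Data.Fin using (Fin; toℕ)
open import Data.List using (List; map; allFin)
open import Data.Nat.ListAction using (sum)
open import Data.Product using (Σ; _×_; ∃)
open import Relation.Binary.PropositionalEquality using (_≡_)
open import Relation.Nullary using (¬_)

record Graph (n : ℕ) : Set where
  field
    adj   : Fin n → Fin n → Bool
    sym   : ∀ v w → adj v w ≡ adj w v
    irr   : ∀ v → adj v v ≡ false
open Graph public

side : (a : ℕ) {n : ℕ} → Fin n → Bool
side a v = toℕ v <ᵇ a

Kadj : (a b : ℕ) → Fin (a + b) → Fin (a + b) → Bool
Kadj a b v w = side a v xor side a w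

private
  xor-comm : ∀ x y → (x xor y) ≡ (y xor x)
  xor-comm false false = _≡_.refl
  xor-comm false true  = _≡_.refl
  xor-comm true  false = _≡_.refl
  xor-comm true  true  = _≡_.refl

  xor-self : ∀ x → (x xor x) ≡ false
  xor-self false = _≡_.refl
  xor-self true  = _≡_.refl

K : (a b : ℕ) → Graph (a + b)
K a b = record
  { adj = Kadj a b
  ; sym = λ v w → xor-comm (side a v) (side a w)
  ; irr = λ v → xor-self (side a v)
  }

Position : ℕ → Set
Position n = Fin n → ℕ

ind : Bool → ℕ
ind true  = 1
ind false = 0

module _ {n : ℕ} (G : Graph n) where

  deg : Fin n → ℕ
  deg v = sum (map (λ w → ind (adj G v w)) (allFin n))

  fires : Position n → Fin n → Bool
  fires σ v = deg v ≤ᵇ σ v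

  Φ : Position n → Fin n → ℕ
  Φ σ v = sum (map (λ w → ind (adj G v w ∧ fires σ w)) (allFin n))

  U : Position n → Position n
  U σ v = if fires σ v then σ v + Φ σ v ∸ deg v else σ v + Φ σ v

  U^ : ℕ → Position n → Position n
  U^ zero    σ = σ
  U^ (suc m) σ = U (U^ m σ)

  EventuallyPeriodic : Position n → ℕ → Set
  EventuallyPeriodic σ p =
    Σ ℕ λ T → ∀ t → T ≤ t → ∀ v → U^ t σ v ≡ U^ (t + p) σ v

  IsPeriod : Position n → ℕ → Set
  IsPeriod σ p =
    1 ≤ p × EventuallyPeriodic σ p × (∀ q → 1 ≤ q → q < p → ¬ EventuallyPeriodic σ q)

{-# OPTIONS --safe #-}
module Submission where

-- Period bound.  If some vertex holds at least twice its degree on the recurrent cycle, it fires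
-- at every step, hence so does every vertex, and the period is 1.  Otherwise the number of firings
-- of v up to time t + 1 is ⌊(σ v + chips received up to time t) / deg v⌋, so the cumulative
-- numbers X, Y of chips received by the two sides satisfy X (t + 1) = F (Y t) and
-- Y (t + 1) = G (X t), where F and G are monotone and commute with translations by the degrees.
-- Thus F ∘ G is a lift of a monotone degree-one circle map on ℤ/c, with c the smaller of a and b
-- after exchanging the sides if necessary: by pigeonhole an orbit returns after q ≤ c iterations,
-- and by monotonicity every orbit that interlaces with it eventually returns after the same q.
-- Hence the period divides 2q with q ≤ min(a, b).
--
-- Realization.  On any graph, give each vertex a class in ℤ/P such that a vertex of class k has a
-- neighbour of class k − 1.  Letting class t mod P fire at time t is a legal game of period P.
-- On K_{a,b}, take P = i with both sides carrying all the classes, or P = 2i with the even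
-- classes on the left and the odd ones on the right.

open import Defs hiding (sym)
open import Data.Nat
open import Data.Nat.Properties
open import Data.Nat.DivMod
open import Data.Nat.Divisibility using (_∣_; divides; n∣m*n; 1∣_; ∣-trans; ∣⇒≤)
open import Data.Nat.Primality using (euclidsLemma; prime[2])
open import Data.Nat.ListAction using (sum)
open import Data.Nat.Tactic.RingSolver using (solve-∀)
open import Data.Bool as Bool using (Bool; true; false; T; if_then_else_; _∧_; not; _xor_)
open import Data.Bool.Properties using (∧-identityʳ; not-involutive; ¬-not)
open import Data.Fin using (Fin; zero; suc; toℕ; fromℕ<; _↑ˡ_; _↑ʳ_)
import Data.Fin.Properties as Fin
open import Data.List using ([]; _∷_; map; allFin)
open import Data.List.Properties using (map-cong; map-tabulate)
open import Data.List.Membership.Propositional using (_∈_)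
open import Data.List.Membership.Propositional.Properties using (∈-allFin)
open import Data.List.Relation.Unary.Any using (here; there)
open import Data.Product using (Σ; _×_; _,_; proj₁; proj₂; ∃; ∃₂)
open import Data.Sum using (_⊎_; inj₁; inj₂)
open import Function.Base using (_∘_)
open import Function.Bundles using (_⇔_; mk⇔)
open import Relation.Nullary using (yes; no; contradiction; ¬_)
open import Relation.Nullary.Decidable using (dec-true; dec-false)
open import Relation.Binary.PropositionalEquality

-- Sums over finite index sets

Σᶠ : ∀ {n} → (Fin n → ℕ) → ℕ
Σᶠ {n} f = sum (map f (allFin n))

sum-map-+ : ∀ {A : Set} (f g : A → ℕ) xs →
            sum (map (λ x → f x + g x) xs) ≡ sum (map f xs) + sum (map g xs)
sum-map-+ f g []       = refl
sum-map-+ f g (x ∷ xs) =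
  trans (cong (f x + g x +_) (sum-map-+ f g xs)) (interchange (f x) _ _ _)
  where
  interchange : ∀ a b c d → a + b + (c + d) ≡ a + c + (b + d)
  interchange = solve-∀

sum-map-mono-≤ : ∀ {A : Set} {f g : A → ℕ} → (∀ x → f x ≤ g x) →
                 ∀ xs → sum (map f xs) ≤ sum (map g xs)
sum-map-mono-≤ f≤g []       = z≤n
sum-map-mono-≤ f≤g (x ∷ xs) = +-mono-≤ (f≤g x) (sum-map-mono-≤ f≤g xs)

sum-map-mono-< : ∀ {A : Set} {f g : A → ℕ} → (∀ x → f x ≤ g x) →
                 ∀ {x xs} → x ∈ xs → f x < g x → sum (map f xs) < sum (map g xs)
sum-map-mono-< f≤g {xs = _ ∷ xs} (here refl)  fx<gx = +-mono-<-≤ fx<gx (sum-map-mono-≤ f≤g xs)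
sum-map-mono-< f≤g {xs = y ∷ _}  (there x∈xs) fx<gx = +-mono-≤-< (f≤g y) (sum-map-mono-< f≤g x∈xs fx<gx)

module _ {n : ℕ} {f g : Fin n → ℕ} where

  Σᶠ-cong : (∀ v → f v ≡ g v) → Σᶠ f ≡ Σᶠ g
  Σᶠ-cong f≗g = cong sum (map-cong f≗g (allFin n))

  Σᶠ-mono-≤ : (∀ v → f v ≤ g v) → Σᶠ f ≤ Σᶠ g
  Σᶠ-mono-≤ f≤g = sum-map-mono-≤ f≤g (allFin n)

  Σᶠ-mono-< : (∀ v → f v ≤ g v) → ∀ v → f v < g v → Σᶠ f < Σᶠ g
  Σᶠ-mono-< f≤g v = sum-map-mono-< f≤g (∈-allFin v)

Σᶠ-+ : ∀ {n} (f g : Fin n → ℕ) → Σᶠ (λ v → f v + g v) ≡ Σᶠ f + Σᶠ g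
Σᶠ-+ {n} f g = sum-map-+ f g (allFin n)

Σᶠ-suc : ∀ {n} (f : Fin (suc n) → ℕ) → Σᶠ f ≡ f zero + Σᶠ (f ∘ suc)
Σᶠ-suc f = cong (f zero +_) (cong sum
  (trans (map-tabulate suc f) (sym (map-tabulate (λ v → v) (f ∘ suc)))))

Σᶠ-const : ∀ n k → Σᶠ {n} (λ _ → k) ≡ n * k
Σᶠ-const zero    k = refl
Σᶠ-const (suc n) k = trans (Σᶠ-suc {n} (λ _ → k)) (cong (k +_) (Σᶠ-const n k))

ind-∧ : ∀ x y → ind (x ∧ y) ≡ ind x * ind y
ind-∧ true  y = sym (+-identityʳ (ind y))
ind-∧ false y = refl

ind-∧-≤ : ∀ x y → ind (x ∧ y) ≤ ind x
ind-∧-≤ true  true  = ≤-refl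
ind-∧-≤ true  false = z≤n
ind-∧-≤ false y     = ≤-refl

≤⇒≤ᵇ≡true : ∀ {m n} → m ≤ n → (m ≤ᵇ n) ≡ true
≤⇒≤ᵇ≡true = dec-true (_ ≤? _)

>⇒≤ᵇ≡false : ∀ {m n} → n < m → (m ≤ᵇ n) ≡ false
>⇒≤ᵇ≡false n<m = dec-false (_ ≤? _) (<⇒≱ n<m)

<ᵇ-suc : ∀ m n → (m <ᵇ suc n) ≡ (m ≤ᵇ n)
<ᵇ-suc zero    n = refl
<ᵇ-suc (suc m) n = refl

-- The parallel chip-firing game on a graph

module _ {n : ℕ} (G : Graph n) where

  U-cong : ∀ {σ τ} → (∀ v → σ v ≡ τ v) → ∀ v → U G σ v ≡ U G τ v
  U-cong {σ} {τ} σ≗τ v =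
    cong₂ (λ x y → if deg G v ≤ᵇ x then x + y ∸ deg G v else x + y) (σ≗τ v)
      (Σᶠ-cong λ w → cong (λ x → ind (adj G v w ∧ (deg G w ≤ᵇ x))) (σ≗τ w))

  U^-cong : ∀ t {σ τ} → (∀ v → σ v ≡ τ v) → ∀ v → U^ G t σ v ≡ U^ G t τ v
  U^-cong zero    σ≗τ = σ≗τ
  U^-cong (suc t) σ≗τ = U-cong (U^-cong t σ≗τ)

  U^-+ : ∀ s t σ → U^ G (s + t) σ ≡ U^ G s (U^ G t σ)
  U^-+ zero    t σ = refl
  U^-+ (suc s) t σ = cong (U G) (U^-+ s t σ)

  fires-true : ∀ σ v → fires G σ v ≡ true → deg G v ≤ σ v
  fires-true σ v eq = ≤ᵇ⇒≤ _ _ (subst T (sym eq) _)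

  Φ≤deg : ∀ σ v → Φ G σ v ≤ deg G v
  Φ≤deg σ v = Σᶠ-mono-≤ λ w → ind-∧-≤ (adj G v w) _

  -- Stated additively, so that no truncated subtraction is left and the identity can be accumulated
  -- over time.
  U-conservation : ∀ σ v → U G σ v + ind (fires G σ v) * deg G v ≡ σ v + Φ G σ v
  U-conservation σ v with fires G σ v in eq
  ... | false = +-identityʳ _
  ... | true  = trans (cong (σ v + Φ G σ v ∸ deg G v +_) (+-identityʳ (deg G v)))
                      (m∸n+n≡m (m≤n⇒m≤n+o _ (fires-true σ v eq)))

  Periodic : Position n → ℕ → Set
  Periodic σ p = ∀ v → U^ G p σ v ≡ σ v

  Periodic-* : ∀ {σ p} → Periodic σ p → ∀ m → Periodic σ (m * p)
  Periodic-*         per zero    v = refl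
  Periodic-* {σ} {p} per (suc m) v = begin
    U^ G (p + m * p) σ v      ≡⟨ cong (λ τ → τ v) (U^-+ p (m * p) σ) ⟩
    U^ G p (U^ G (m * p) σ) v ≡⟨ U^-cong p (Periodic-* per m) v ⟩
    U^ G p σ v                ≡⟨ per v ⟩
    σ v                       ∎
    where open ≡-Reasoning

  Periodic⇒EventuallyPeriodic : ∀ {σ p} → Periodic σ p → EventuallyPeriodic G σ p
  Periodic⇒EventuallyPeriodic {σ} {p} per = 0 , λ t _ v →
    trans (U^-cong t (sym ∘ per) v) (cong (λ τ → τ v) (sym (U^-+ t p σ)))

  -- The time `T * p` is at least `T` and brings `σ` back, so the eventual identity can be read at
  -- the initial position itself.
  EventuallyPeriodic⇒Periodic : ∀ {σ p q} → 1 ≤ p → Periodic σ p →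
                                EventuallyPeriodic G σ q → Periodic σ q
  EventuallyPeriodic⇒Periodic {σ} {p@(suc _)} {q} 1≤p per (T , ep) v = begin
    U^ G q σ v              ≡⟨ U^-cong q (sym ∘ Periodic-* per T) v ⟩
    U^ G q (U^ G (T * p) σ) v ≡⟨ cong (λ τ → τ v) (U^-+ q (T * p) σ) ⟨
    U^ G (q + T * p) σ v    ≡⟨ cong (λ t → U^ G t σ v) (+-comm q (T * p)) ⟩
    U^ G (T * p + q) σ v    ≡⟨ ep (T * p) (m≤m*n T p) v ⟨
    U^ G (T * p) σ v        ≡⟨ Periodic-* per T v ⟩
    σ v                     ∎
    where open ≡-Reasoning

  eventually⇒shifted-periodic : ∀ {σ p} ((T , _) : EventuallyPeriodic G σ p) →
                                Periodic (U^ G T σ) p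
  eventually⇒shifted-periodic {σ} {p} (T , ep) v = begin
    U^ G p (U^ G T σ) v ≡⟨ cong (λ τ → τ v) (U^-+ p T σ) ⟨
    U^ G (p + T) σ v    ≡⟨ cong (λ t → U^ G t σ v) (+-comm p T) ⟩
    U^ G (T + p) σ v    ≡⟨ ep T ≤-refl v ⟨
    U^ G T σ v          ∎
    where open ≡-Reasoning

  shifted-eventually : ∀ {σ q} T → EventuallyPeriodic G (U^ G T σ) q → EventuallyPeriodic G σ q
  shifted-eventually {σ} {q} T (T′ , ep) = T′ + T , λ t T′+T≤t v →
    let s = t ∸ T
        t≡s+T = sym (m∸n+n≡m (m+n≤o⇒n≤o T′ T′+T≤t))
    in begin
    U^ G t σ v                ≡⟨ cong (λ t → U^ G t σ v) t≡s+T ⟩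
    U^ G (s + T) σ v          ≡⟨ cong (λ τ → τ v) (U^-+ s T σ) ⟩
    U^ G s (U^ G T σ) v       ≡⟨ ep s (m+n≤o⇒m≤o∸n T′ T′+T≤t) v ⟩
    U^ G (s + q) (U^ G T σ) v ≡⟨ cong (λ τ → τ v) (U^-+ (s + q) T σ) ⟨
    U^ G (s + q + T) σ v      ≡⟨ cong (λ t → U^ G t σ v) (swap s q T) ⟩
    U^ G (s + T + q) σ v      ≡⟨ cong (λ t → U^ G (t + q) σ v) t≡s+T ⟨
    U^ G (t + q) σ v          ∎
    where
    open ≡-Reasoning
    swap : ∀ s q T → s + q + T ≡ s + T + q
    swap = solve-∀

  period-∣ : ∀ {σ p N} → IsPeriod G σ p → EventuallyPeriodic G σ N → p ∣ N
  period-∣ {σ} {p@(suc _)} {N} (_ , (T , ep) , least) (T′ , ep′)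
    with N % p in eq
  ... | zero  = divides (N / p) (trans (m≡m%n+[m/n]*n N p) (cong (_+ N / p * p) eq))
  ... | suc r = contradiction (T + T′ , ep-r) (least (suc r) (s≤s z≤n) (subst (_< p) eq (m%n<n N p)))
    where
    open ≡-Reasoning
    ep-* : ∀ m t → T ≤ t → ∀ v → U^ G t σ v ≡ U^ G (t + m * p) σ v
    ep-* zero    t T≤t v = cong (λ t → U^ G t σ v) (sym (+-identityʳ t))
    ep-* (suc m) t T≤t v = begin
      U^ G t σ v             ≡⟨ ep t T≤t v ⟩
      U^ G (t + p) σ v       ≡⟨ ep-* m (t + p) (m≤n⇒m≤n+o p T≤t) v ⟩
      U^ G (t + p + m * p) σ v ≡⟨ cong (λ t → U^ G t σ v) (+-assoc t p (m * p)) ⟩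
      U^ G (t + (p + m * p)) σ v ∎
    ep-r : ∀ t → T + T′ ≤ t → ∀ v → U^ G t σ v ≡ U^ G (t + suc r) σ v
    ep-r t T+T′≤t v = begin
      U^ G t σ v                           ≡⟨ ep′ t (m+n≤o⇒n≤o T T+T′≤t) v ⟩
      U^ G (t + N) σ v                     ≡⟨ cong (λ s → U^ G (t + s) σ v) (m≡m%n+[m/n]*n N p) ⟩
      U^ G (t + (N % p + N / p * p)) σ v   ≡⟨ cong (λ s → U^ G (t + (s + N / p * p)) σ v) eq ⟩
      U^ G (t + (suc r + N / p * p)) σ v   ≡⟨ cong (λ s → U^ G s σ v) (+-assoc t (suc r) (N / p * p)) ⟨
      U^ G (t + suc r + N / p * p) σ v     ≡⟨ ep-* (N / p) (t + suc r) (m≤n⇒m≤n+o (suc r) (m+n≤o⇒m≤o T T+T′≤t)) v ⟨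
      U^ G (t + suc r) σ v                 ∎

  -- A firing vertex loses its degree and gains at most its degree; a resting one starts below its
  -- degree and gains at most that much.
  confined-at-U : ∀ σ v → σ v < deg G v + deg G v → U G σ v < deg G v + deg G v
  confined-at-U σ v lt with fires G σ v in eq
  ... | false = +-mono-<-≤ (≰⇒> λ le → contradiction (trans (sym eq) (≤⇒≤ᵇ≡true le)) λ ()) (Φ≤deg σ v)
  ... | true  = ≤-<-trans
    (≤-trans (∸-monoˡ-≤ (deg G v) (+-monoʳ-≤ (σ v) (Φ≤deg σ v))) (≤-reflexive (m+n∸n≡m (σ v) (deg G v)))) lt

  confined-at-U^ : ∀ t σ v → σ v < deg G v + deg G v → U^ G t σ v < deg G v + deg G v
  confined-at-U^ zero    σ v lt = lt
  confined-at-U^ (suc t) σ v lt = confined-at-U _ v (confined-at-U^ t σ v lt)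

  -- Vertices that fire at every step

  AlwaysFires : Position n → Fin n → Set
  AlwaysFires σ v = ∀ t → deg G v ≤ U^ G t σ v

  module _ {p : ℕ} where

    Periodic-U^ : ∀ {σ} → Periodic σ p → ∀ t → Periodic (U^ G t σ) p
    Periodic-U^ {σ} per t v = begin
      U^ G p (U^ G t σ) v ≡⟨ cong (λ τ → τ v) (U^-+ p t σ) ⟨
      U^ G (p + t) σ v    ≡⟨ cong (λ t → U^ G t σ v) (+-comm p t) ⟩
      U^ G (t + p) σ v    ≡⟨ cong (λ τ → τ v) (U^-+ t p σ) ⟩
      U^ G t (U^ G p σ) v ≡⟨ U^-cong t per v ⟩
      U^ G t σ v          ∎
      where open ≡-Reasoning

    -- A vertex resting at time `t` is below its degree, hence below twice its degree from then on.
    -- Periodicity restores `σ` at time `t * p`, which contradicts the hypothesis.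
    unconfined⇒always-fires : ∀ {σ v} → 1 ≤ p → Periodic σ p →
                              ¬ (σ v < deg G v + deg G v) → AlwaysFires σ v
    unconfined⇒always-fires {σ} {v} 1≤p per ≮ t = ≮⇒≥ λ lt →
      ≮ (subst (_< deg G v + deg G v) back
          (confined-at-U^ (t * p ∸ t) (U^ G t σ) v (m≤n⇒m≤n+o (deg G v) lt)))
      where
      open ≡-Reasoning
      back : U^ G (t * p ∸ t) (U^ G t σ) v ≡ σ v
      back = begin
        U^ G (t * p ∸ t) (U^ G t σ) v ≡⟨ cong (λ τ → τ v) (U^-+ (t * p ∸ t) t σ) ⟨
        U^ G (t * p ∸ t + t) σ v      ≡⟨ cong (λ s → U^ G s σ v) (m∸n+n≡m (m≤m*n t p ⦃ >-nonZero 1≤p ⦄)) ⟩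
        U^ G (t * p) σ v              ≡⟨ Periodic-* per t v ⟩
        σ v                           ∎

    always-fires-U : ∀ {σ v} → AlwaysFires σ v → U G σ v + deg G v ≡ σ v + Φ G σ v
    always-fires-U {σ} {v} always = trans
      (cong (U G σ v +_) (trans (sym (*-identityˡ (deg G v)))
        (cong (λ x → ind x * deg G v) (sym (≤⇒≤ᵇ≡true (always 0))))))
      (U-conservation σ v)

    always-fires-U^ : ∀ {σ v} → AlwaysFires σ v → ∀ t → AlwaysFires (U^ G t σ) v
    always-fires-U^ {σ} {v} always t s =
      subst (deg G v ≤_) (cong (λ τ → τ v) (U^-+ s t σ)) (always (s + t))

    -- A vertex that always fires never gains chips, so by periodicity it never loses any.
    always-fires⇒Φ≡deg : ∀ {σ v} → 1 ≤ p → Periodic σ p → AlwaysFires σ v → Φ G σ v ≡ deg G v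
    always-fires⇒Φ≡deg {σ} {v} 1≤p per always =
      ≤-antisym (Φ≤deg σ v) (+-cancelˡ-≤ (σ v) _ _ (begin
        σ v + deg G v     ≤⟨ +-monoˡ-≤ (deg G v) (σ≤Uσ 1≤p per) ⟩
        U G σ v + deg G v ≡⟨ always-fires-U always ⟩
        σ v + Φ G σ v     ∎))
      where
      open ≤-Reasoning
      loses : ∀ {τ} → AlwaysFires τ v → U G τ v ≤ τ v
      loses {τ} always = +-cancelʳ-≤ (deg G v) _ _ (begin
        U G τ v + deg G v ≡⟨ always-fires-U always ⟩
        τ v + Φ G τ v     ≤⟨ +-monoʳ-≤ (τ v) (Φ≤deg τ v) ⟩
        τ v + deg G v     ∎)
      U^≤U : ∀ t → U^ G (suc t) σ v ≤ U G σ v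
      U^≤U zero    = ≤-refl
      U^≤U (suc t) = ≤-trans (loses (always-fires-U^ always (suc t))) (U^≤U t)
      σ≤Uσ : ∀ {p} → 1 ≤ p → Periodic σ p → σ v ≤ U G σ v
      σ≤Uσ {suc p} _ per = subst (_≤ U G σ v) (per v) (U^≤U p)

    always-fires⇒fixed : ∀ {σ v} → 1 ≤ p → Periodic σ p → AlwaysFires σ v → U G σ v ≡ σ v
    always-fires⇒fixed {σ} {v} 1≤p per always = +-cancelʳ-≡ (deg G v) _ _
      (trans (always-fires-U always) (cong (σ v +_) (always-fires⇒Φ≡deg 1≤p per always)))

    -- If `w` rested at some time, `v` would receive fewer chips than its degree in that step.
    always-fires-spreads : ∀ {σ v w} → 1 ≤ p → Periodic σ p → adj G v w ≡ true →
                           AlwaysFires σ v → AlwaysFires σ w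
    always-fires-spreads {σ} {v} {w} 1≤p per vw always t = ≮⇒≥ λ lt →
      <-irrefl (always-fires⇒Φ≡deg 1≤p (Periodic-U^ per t) (always-fires-U^ always t))
        (Σᶠ-mono-< (λ u → ind-∧-≤ (adj G v u) _) w (strict lt))
      where
      strict : U^ G t σ w < deg G w → ind (adj G v w ∧ fires G (U^ G t σ) w) < ind (adj G v w)
      strict lt rewrite vw | >⇒≤ᵇ≡false lt = s≤s z≤n

-- Positions with prescribed period

-- Subtraction of 1 modulo `suc P` on the representatives 0 to `P`; the cycle has length `suc P`,
-- not `P`.
rotate : ℕ → ℕ → ℕ
rotate P zero    = P
rotate P (suc k) = k

rotate^ : ℕ → ℕ → ℕ → ℕ
rotate^ P zero    k = k
rotate^ P (suc t) k = rotate P (rotate^ P t k)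

rotate-≤ : ∀ {P k} → k ≤ P → rotate P k ≤ P
rotate-≤ {k = zero}  _   = ≤-refl
rotate-≤ {k = suc k} k<P = <⇒≤ k<P

rotate^-+ : ∀ P s t k → rotate^ P (s + t) k ≡ rotate^ P s (rotate^ P t k)
rotate^-+ P zero    t k = refl
rotate^-+ P (suc s) t k = cong (rotate P) (rotate^-+ P s t k)

rotate^-∸ : ∀ P j k → rotate^ P j (j + k) ≡ k
rotate^-∸ P zero    k = refl
rotate^-∸ P (suc j) k = cong (rotate P)
  (trans (cong (rotate^ P j) (sym (+-suc j k))) (rotate^-∸ P j (suc k)))

-- Count down `k` steps to 0, wrap around to `P`, then count down the remaining `P ∸ k` steps.
rotate^-full : ∀ {P k} → k ≤ P → rotate^ P (suc P) k ≡ k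
rotate^-full {P} {k} k≤P = begin
  rotate^ P (suc P) k                            ≡⟨ cong (λ s → rotate^ P (suc s) k) (m∸n+n≡m k≤P) ⟨
  rotate^ P (suc (j + k)) k                      ≡⟨ cong (λ s → rotate^ P s k) (+-suc j k) ⟨
  rotate^ P (j + suc k) k                        ≡⟨ rotate^-+ P j (suc k) k ⟩
  rotate^ P j (rotate P (rotate^ P k k))         ≡⟨ cong (λ s → rotate^ P j (rotate P (rotate^ P k s))) (+-identityʳ k) ⟨
  rotate^ P j (rotate P (rotate^ P k (k + 0)))   ≡⟨ cong (rotate^ P j ∘ rotate P) (rotate^-∸ P k 0) ⟩
  rotate^ P j P                                  ≡⟨ cong (rotate^ P j) (m∸n+n≡m k≤P) ⟨
  rotate^ P j (j + k)                            ≡⟨ rotate^-∸ P j k ⟩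
  k                                              ∎
  where
  open ≡-Reasoning
  j = P ∸ k

rotate^-zero : ∀ {P q} → 1 ≤ q → q ≤ P → 0 < rotate^ P q 0
rotate^-zero {P} {suc q} _ q<P = subst (0 <_) (sym eq) (m<n⇒0<n∸m q<P)
  where
  open ≡-Reasoning
  eq : rotate^ P (suc q) 0 ≡ P ∸ q
  eq = begin
    rotate^ P (suc q) 0          ≡⟨ cong (λ s → rotate^ P s 0) (+-comm 1 q) ⟩
    rotate^ P (q + 1) 0          ≡⟨ rotate^-+ P q 1 0 ⟩
    rotate^ P q P                ≡⟨ cong (rotate^ P q) (m+[n∸m]≡n (<⇒≤ q<P)) ⟨
    rotate^ P q (q + (P ∸ q))    ≡⟨ rotate^-∸ P q (P ∸ q) ⟩
    P ∸ q                        ∎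

module Rotation {n : ℕ} (G : Graph n) (P : ℕ) where

  -- A vertex of class k is due to fire k steps from now, right after a neighbour does.
  record Schedule (c : Fin n → ℕ) : Set where
    field
      bounded     : ∀ v → c v ≤ P
      predecessor : ∀ v → ∃ λ w → adj G v w ≡ true × c w ≡ rotate P (c v)
  open Schedule

  -- A vertex holds the chips that it received since it last fired.
  position : (Fin n → ℕ) → Position n
  position c v = Σᶠ λ w → ind (adj G v w ∧ (c v ≤ᵇ c w))

  rotate-schedule : ∀ {c} → Schedule c → Schedule (rotate P ∘ c)
  rotate-schedule S .bounded     v = rotate-≤ (S .bounded v)
  rotate-schedule S .predecessor v =
    let w , vw , eq = S .predecessor v in w , vw , cong (rotate P) eq

  rotate^-schedule : ∀ t {c} → Schedule c → Schedule (rotate^ P t ∘ c)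
  rotate^-schedule zero    S = S
  rotate^-schedule (suc t) S = rotate-schedule (rotate^-schedule t S)

  -- In class 0 every neighbour is counted, so the vertex holds exactly its degree. In class `suc k`
  -- the neighbour of class `k` is left out, so the vertex falls short.
  position-fires : ∀ {c} → Schedule c → ∀ v → fires G (position c) v ≡ (c v ≤ᵇ 0)
  position-fires {c} S v with c v | S .predecessor v
  ... | zero  | _ =
    ≤⇒≤ᵇ≡true (≤-reflexive (Σᶠ-cong λ w → cong ind (sym (∧-identityʳ (adj G v w)))))
  ... | suc k | w , vw , cw≡k =
    >⇒≤ᵇ≡false (Σᶠ-mono-< (λ w → ind-∧-≤ (adj G v w) _) w strict)
    where
    strict : ind (adj G v w ∧ (suc k ≤ᵇ c w)) < ind (adj G v w)
    strict rewrite vw | cw≡k | >⇒≤ᵇ≡false (n<1+n k) = s≤s z≤n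

  -- A vertex of class 0 spends all its chips and keeps those arriving from neighbours of class 0,
  -- which rotate to `P` together with it. A vertex of class `suc k` adds its neighbours of class 0
  -- to those of class above `k`; after rotation these are the neighbours of class at least `k`.
  U-position : ∀ {c} → Schedule c → ∀ v → U G (position c) v ≡ position (rotate P ∘ c) v
  U-position {c} S v
    rewrite position-fires S v
          | Σᶠ-cong {f = λ w → ind (adj G v w ∧ fires G (position c) w)}
                    (λ w → cong (λ x → ind (adj G v w ∧ x)) (position-fires S w))
    with c v | S .bounded v
  ... | zero | _ = begin
    Σᶠ (λ w → ind (adj G v w ∧ true)) + Σᶠ (λ w → ind (adj G v w ∧ (c w ≤ᵇ 0))) ∸ deg G v
      ≡⟨ cong (λ d → d + received ∸ deg G v) (Σᶠ-cong λ w → cong ind (∧-identityʳ (adj G v w))) ⟩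
    deg G v + received ∸ deg G v
      ≡⟨ m+n∸m≡n (deg G v) received ⟩
    received
      ≡⟨ Σᶠ-cong (λ w → cong (λ x → ind (adj G v w ∧ x)) (last-class (S .bounded w))) ⟩
    Σᶠ (λ w → ind (adj G v w ∧ (P ≤ᵇ rotate P (c w)))) ∎
    where
    open ≡-Reasoning
    received = Σᶠ (λ w → ind (adj G v w ∧ (c w ≤ᵇ 0)))
    last-class : ∀ {k} → k ≤ P → (k ≤ᵇ 0) ≡ (P ≤ᵇ rotate P k)
    last-class {zero}  _   = sym (≤⇒≤ᵇ≡true (≤-refl {P}))
    last-class {suc k} k<P = sym (>⇒≤ᵇ≡false k<P)
  ... | suc k | k<P = begin
    Σᶠ (λ w → ind (adj G v w ∧ (k <ᵇ c w))) + Σᶠ (λ w → ind (adj G v w ∧ (c w ≤ᵇ 0)))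
      ≡⟨ Σᶠ-+ (λ w → ind (adj G v w ∧ (k <ᵇ c w))) (λ w → ind (adj G v w ∧ (c w ≤ᵇ 0))) ⟨
    Σᶠ (λ w → ind (adj G v w ∧ (k <ᵇ c w)) + ind (adj G v w ∧ (c w ≤ᵇ 0)))
      ≡⟨ Σᶠ-cong (λ w → merge (adj G v w) (c w)) ⟩
    Σᶠ (λ w → ind (adj G v w ∧ (k ≤ᵇ rotate P (c w)))) ∎
    where
    open ≡-Reasoning
    merge : ∀ x m → ind (x ∧ (k <ᵇ m)) + ind (x ∧ (m ≤ᵇ 0)) ≡ ind (x ∧ (k ≤ᵇ rotate P m))
    merge false m       = refl
    merge true  zero    = cong ind (sym (≤⇒≤ᵇ≡true (<⇒≤ k<P)))
    merge true  (suc m) = trans (+-identityʳ _) (cong ind (<ᵇ-suc k m))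

  U^-position : ∀ {c} → Schedule c → ∀ t v → U^ G t (position c) v ≡ position (rotate^ P t ∘ c) v
  U^-position S zero    v = refl
  U^-position S (suc t) v =
    trans (U-cong G (U^-position S t) v) (U-position (rotate^-schedule t S) v)

  position-cong : ∀ {c c′} → (∀ v → c v ≡ c′ v) → ∀ v → position c v ≡ position c′ v
  position-cong c≗c′ v = Σᶠ-cong λ w →
    cong₂ (λ x y → ind (adj G v w ∧ (x ≤ᵇ y))) (c≗c′ v) (c≗c′ w)

  -- All classes recur after `suc P` rotations. At any earlier positive time `v₀` has a nonzero
  -- class and rests, whereas it fires at time 0.
  position-period : ∀ {c} → Schedule c → ∀ v₀ → c v₀ ≡ 0 → IsPeriod G (position c) (suc P)
  position-period {c} S v₀ cv₀≡0 = s≤s z≤n , Periodic⇒EventuallyPeriodic G periodic , least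
    where
    periodic : Periodic G (position c) (suc P)
    periodic v = trans (U^-position S (suc P) v)
      (position-cong (λ w → rotate^-full (S .bounded w)) v)
    least : ∀ q → 1 ≤ q → q < suc P → ¬ EventuallyPeriodic G (position c) q
    least q 1≤q (s≤s q≤P) ep = contradiction (begin
      true                                ≡⟨ cong (_≤ᵇ 0) cv₀≡0 ⟨
      (c v₀ ≤ᵇ 0)                         ≡⟨ position-fires S v₀ ⟨
      fires G (position c) v₀
        ≡⟨ cong (deg G v₀ ≤ᵇ_) (trans (sym (U^-position S q v₀)) (periodic-q v₀)) ⟨
      fires G (position (rotate^ P q ∘ c)) v₀
        ≡⟨ position-fires (rotate^-schedule q S) v₀ ⟩
      (rotate^ P q (c v₀) ≤ᵇ 0)           ≡⟨ cong (λ k → rotate^ P q k ≤ᵇ 0) cv₀≡0 ⟩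
      (rotate^ P q 0 ≤ᵇ 0)                ≡⟨ >⇒≤ᵇ≡false (rotate^-zero 1≤q q≤P) ⟩
      false                               ∎) λ ()
      where
      open ≡-Reasoning
      periodic-q : Periodic G (position c) q
      periodic-q = EventuallyPeriodic⇒Periodic G {σ = position c} {p = suc P} {q = q} (s≤s z≤n) periodic ep

-- Interleaved monotone recursions

-- Natural numbers cannot decrease strictly forever; `go` recurses on an upper bound for the current
-- value.
antitone-plateau : (f : ℕ → ℕ) → (∀ n → f (suc n) ≤ f n) → ∃ λ n → f (suc n) ≡ f n
antitone-plateau f anti = go (f 0) 0 ≤-refl
  where
  go : ∀ bound n → f n ≤ bound → ∃ λ m → f (suc m) ≡ f m
  go bound n fn≤ with m≤n⇒m<n∨m≡n (anti n)
  ... | inj₂ eq = n , eq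
  go zero n fn≤ | inj₁ lt = contradiction (<-≤-trans lt fn≤) λ ()
  go (suc bound) n fn≤ | inj₁ lt = go bound (suc n) (s≤s⁻¹ (<-≤-trans lt fn≤))

%-≡⇒∃* : ∀ {m n} d .{{_ : NonZero d}} → m ≤ n → m % d ≡ n % d → ∃ λ k → n ≡ m + k * d
%-≡⇒∃* {m} {n} d m≤n eq = n / d ∸ m / d , (begin
  n                                              ≡⟨ m≡m%n+[m/n]*n n d ⟩
  n % d + n / d * d                              ≡⟨ cong₂ (λ r q → r + q * d) (sym eq) (sym (m+[n∸m]≡n (/-monoˡ-≤ d m≤n))) ⟩
  m % d + (m / d + (n / d ∸ m / d)) * d          ≡⟨ rearrange (m % d) (m / d) _ d ⟩
  m % d + m / d * d + (n / d ∸ m / d) * d        ≡⟨ cong (_+ (n / d ∸ m / d) * d) (m≡m%n+[m/n]*n m d) ⟨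
  m + (n / d ∸ m / d) * d                        ∎)
  where
  open ≡-Reasoning
  rearrange : ∀ r a b d → r + (a + b) * d ≡ r + a * d + b * d
  rearrange = solve-∀

module Interleaved
  {F G : ℕ → ℕ} {c d : ℕ} .{{_ : NonZero c}}
  (F-mono : ∀ {x y} → x ≤ y → F x ≤ F y) (F-shift : ∀ x → F (x + d) ≡ F x + c)
  (G-mono : ∀ {x y} → x ≤ y → G x ≤ G y) (G-shift : ∀ x → G (x + c) ≡ G x + d)
  {X Y : ℕ → ℕ}
  (X-step : ∀ t → X (suc t) ≡ F (Y t)) (Y-step : ∀ t → Y (suc t) ≡ G (X t))
  (X-mono : ∀ t → X t ≤ X (suc t))
  where

  shift-* : ∀ {h : ℕ → ℕ} {m n} → (∀ x → h (x + m) ≡ h x + n) → ∀ k x → h (x + k * m) ≡ h x + k * n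
  shift-* {h} {m} {n} sh zero    x = trans (cong h (+-identityʳ x)) (sym (+-identityʳ (h x)))
  shift-* {h} {m} {n} sh (suc k) x = begin
    h (x + (m + k * m)) ≡⟨ cong h (+-assoc x m (k * m)) ⟨
    h (x + m + k * m)   ≡⟨ shift-* sh k (x + m) ⟩
    h (x + m) + k * n   ≡⟨ cong (_+ k * n) (sh x) ⟩
    h x + n + k * n     ≡⟨ +-assoc (h x) n (k * n) ⟩
    h x + (n + k * n)   ∎
    where open ≡-Reasoning

  H : ℕ → ℕ
  H = F ∘ G

  H-mono : ∀ {x y} → x ≤ y → H x ≤ H y
  H-mono = F-mono ∘ G-mono

  H-shift : ∀ k x → H (x + k * c) ≡ H x + k * c
  H-shift k x = trans (cong F (shift-* G-shift k x)) (shift-* F-shift k (G x))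

  X-step₂ : ∀ t → X (2 + t) ≡ H (X t)
  X-step₂ t = trans (X-step (suc t)) (cong F (Y-step t))

  X-mono-+ : ∀ n t → X t ≤ X (n + t)
  X-mono-+ zero    t = ≤-refl
  X-mono-+ (suc n) t = ≤-trans (X-mono-+ n t) (X-mono (n + t))

  X-≤-step : ∀ {s t} k → X s ≤ X t + k * c → X (2 + s) ≤ X (2 + t) + k * c
  X-≤-step {s} {t} k le = subst₂ _≤_ (sym (X-step₂ s))
    (trans (H-shift k (X t)) (cong (_+ k * c) (sym (X-step₂ t)))) (H-mono le)

  X-≥-step : ∀ {s t} k → X t + k * c ≤ X s → X (2 + t) + k * c ≤ X (2 + s)
  X-≥-step {s} {t} k le = subst₂ _≤_
    (trans (H-shift k (X t)) (cong (_+ k * c) (sym (X-step₂ t)))) (sym (X-step₂ s)) (H-mono le)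

  module _ (q k : ℕ) where

    X-≤-steps : ∀ r {s t} → X s ≤ X t + k * c → X (r * 2 + s) ≤ X (r * 2 + t) + k * c
    X-≤-steps zero    le = le
    X-≤-steps (suc r) le = X-≤-step k (X-≤-steps r le)

    X-≥-steps : ∀ r {s t} → X t + k * c ≤ X s → X (r * 2 + t) + k * c ≤ X (r * 2 + s)
    X-≥-steps zero    le = le
    X-≥-steps (suc r) le = X-≥-step k (X-≥-steps r le)

    -- Here `q` counts iterations of `H`, each worth two time steps, and `k` counts turns around the
    -- circle of length `c`.
    Returns : ℕ → Set
    Returns t = X (q * 2 + t) ≡ X t + k * c

    returns-step : ∀ {t} → Returns t → Returns (2 + t)
    returns-step {t} ret = begin
      X (q * 2 + (2 + t)) ≡⟨ cong X (shuffle (q * 2) t) ⟩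
      X (2 + (q * 2 + t)) ≡⟨ X-step₂ (q * 2 + t) ⟩
      H (X (q * 2 + t))   ≡⟨ cong H ret ⟩
      H (X t + k * c)     ≡⟨ H-shift k (X t) ⟩
      H (X t) + k * c     ≡⟨ cong (_+ k * c) (X-step₂ t) ⟨
      X (2 + t) + k * c   ∎
      where
      open ≡-Reasoning
      shuffle : ∀ m t → m + (2 + t) ≡ 2 + (m + t)
      shuffle = solve-∀

    returns-Y : ∀ {t} → Returns t → Y (q * 2 + suc t) ≡ Y (suc t) + k * d
    returns-Y {t} ret = begin
      Y (q * 2 + suc t)   ≡⟨ cong Y (+-suc (q * 2) t) ⟩
      Y (suc (q * 2 + t)) ≡⟨ Y-step (q * 2 + t) ⟩
      G (X (q * 2 + t))   ≡⟨ cong G ret ⟩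
      G (X t + k * c)     ≡⟨ shift-* G-shift k (X t) ⟩
      G (X t) + k * d     ≡⟨ cong (_+ k * d) (Y-step t) ⟨
      Y (suc t) + k * d   ∎
      where open ≡-Reasoning

    -- `H` advances time by two, so each parity needs a return of its own to start from.
    returns-both : ∀ T → Returns T → Returns (suc T) → ∀ n → Returns (n + T)
    returns-both T r₀ r₁ zero          = r₀
    returns-both T r₀ r₁ (suc zero)    = r₁
    returns-both T r₀ r₁ (suc (suc n)) = returns-step (returns-both T r₀ r₁ n)

    module _ {t₀ : ℕ} (ret : Returns t₀) where

      time : ℕ → ℕ
      time zero    = t₀
      time (suc n) = q * 2 + time n

      returns-+* : ∀ r {t} → Returns t → Returns (r * 2 + t)
      returns-+* zero    ret = ret
      returns-+* (suc r) ret = returns-step (returns-+* r ret)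

      returns-time : ∀ n → Returns (time n)
      returns-time zero    = ret
      returns-time (suc n) = returns-+* q (returns-time n)

      X-time : ∀ n → X (time n) ≡ X t₀ + n * (k * c)
      X-time zero    = sym (+-identityʳ _)
      X-time (suc n) = trans (returns-time n) (trans (cong (_+ k * c) (X-time n)) (rearrange (X t₀) _ (k * c)))
        where
        rearrange : ∀ x y z → x + y + z ≡ x + (z + y)
        rearrange = solve-∀

      H-X-time : ∀ n → X (2 + time n) ≡ X (2 + t₀) + n * (k * c)
      H-X-time n = begin
        X (2 + time n)              ≡⟨ X-step₂ (time n) ⟩
        H (X (time n))              ≡⟨ cong H (trans (X-time n) (cong (X t₀ +_) (sym (*-assoc n k c)))) ⟩
        H (X t₀ + n * k * c)        ≡⟨ H-shift (n * k) (X t₀) ⟩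
        H (X t₀) + n * k * c        ≡⟨ cong₂ _+_ (sym (X-step₂ t₀)) (*-assoc n k c) ⟩
        X (2 + t₀) + n * (k * c)    ∎
        where open ≡-Reasoning

      -- Samples `X` at the parity opposite to `t₀`. Each `Z n` is caught between `X (time n)` and
      -- `X (2 + time n)`, and both of these bounds grow by exactly `k * c` per stage.
      Z : ℕ → ℕ
      Z n = X (suc (time n))

      Z-suc : ∀ n → X (q * 2 + suc (time n)) ≡ Z (suc n)
      Z-suc n = cong X (+-suc (q * 2) (time n))

      Z-lower : ∀ n → n * (k * c) ≤ Z n
      Z-lower n = ≤-trans (m≤n+m _ (X t₀)) (≤-trans (≤-reflexive (sym (X-time n))) (X-mono (time n)))

      Z-upper : ∀ n → Z n ≤ X (2 + t₀) + n * (k * c)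
      Z-upper n = ≤-trans (X-mono (suc (time n))) (≤-reflexive (H-X-time n))

      -- Applying `H` another `q` times carries the comparison from one stage to the next, so the
      -- first difference decides the direction of all.
      Z-≤ : Z 1 ≤ Z 0 + k * c → ∀ n → Z (suc n) ≤ Z n + k * c
      Z-≤ le zero    = le
      Z-≤ le (suc n) = subst₂ (λ x y → x ≤ y + k * c) (Z-suc (suc n)) (Z-suc n) (X-≤-steps q (Z-≤ le n))

      Z-≥ : Z 0 + k * c ≤ Z 1 → ∀ n → Z n + k * c ≤ Z (suc n)
      Z-≥ le zero    = le
      Z-≥ le (suc n) = subst₂ (λ x y → y + k * c ≤ x) (Z-suc (suc n)) (Z-suc n) (X-≥-steps q (Z-≥ le n))

      -- The sequence Z lies between two arithmetic progressions of difference k * c, and its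
      -- own differences all lie on the same side of k * c, so one of them is exactly k * c.
      Z-returns : ∃ λ n → Z (suc n) ≡ Z n + k * c
      Z-returns with ≤-total (Z 1) (Z 0 + k * c)
      ... | inj₁ le = let n , eq = antitone-plateau (λ n → Z n ∸ n * (k * c)) anti in n , (begin
        Z (suc n)                                      ≡⟨ m∸n+n≡m (Z-lower (suc n)) ⟨
        Z (suc n) ∸ suc n * (k * c) + suc n * (k * c)  ≡⟨ cong (_+ suc n * (k * c)) eq ⟩
        Z n ∸ n * (k * c) + (k * c + n * (k * c))      ≡⟨ rearrange (Z n ∸ n * (k * c)) (k * c) _ ⟩
        Z n ∸ n * (k * c) + n * (k * c) + k * c        ≡⟨ cong (_+ k * c) (m∸n+n≡m (Z-lower n)) ⟩
        Z n + k * c                                    ∎)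
        where
        open ≡-Reasoning
        rearrange : ∀ x y z → x + (y + z) ≡ x + z + y
        rearrange = solve-∀
        anti : ∀ n → Z (suc n) ∸ suc n * (k * c) ≤ Z n ∸ n * (k * c)
        anti n = ≤-trans (∸-monoˡ-≤ (suc n * (k * c)) (Z-≤ le n))
          (≤-reflexive (trans (cong (_∸ suc n * (k * c)) (+-comm (Z n) (k * c)))
                              ([m+n]∸[m+o]≡n∸o (k * c) (Z n) _)))
      ... | inj₂ ge = let n , eq = antitone-plateau (λ n → W n ∸ Z n) anti in
        n , +-cancelˡ-≡ (W (suc n) ∸ Z (suc n)) _ _ (begin
        W (suc n) ∸ Z (suc n) + Z (suc n)              ≡⟨ m∸n+n≡m (Z-upper (suc n)) ⟩
        W (suc n)                                      ≡⟨ W-suc n ⟩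
        W n + k * c                                    ≡⟨ cong (_+ k * c) (m∸n+n≡m (Z-upper n)) ⟨
        W n ∸ Z n + Z n + k * c                        ≡⟨ +-assoc (W n ∸ Z n) (Z n) (k * c) ⟩
        W n ∸ Z n + (Z n + k * c)                      ≡⟨ cong (_+ (Z n + k * c)) eq ⟨
        W (suc n) ∸ Z (suc n) + (Z n + k * c)          ∎)
        where
        open ≡-Reasoning
        W : ℕ → ℕ
        W n = X (2 + t₀) + n * (k * c)
        rearrange : ∀ x y z → x + (y + z) ≡ x + z + y
        rearrange = solve-∀
        W-suc : ∀ n → W (suc n) ≡ W n + k * c
        W-suc n = rearrange (X (2 + t₀)) (k * c) _
        anti : ∀ n → W (suc n) ∸ Z (suc n) ≤ W n ∸ Z n
        anti n = ≤-trans (∸-monoʳ-≤ (W (suc n)) (Z-≥ ge n))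
          (≤-reflexive (trans (cong₂ _∸_ (trans (W-suc n) (+-comm (W n) _)) (+-comm (Z n) (k * c)))
                              ([m+n]∸[m+o]≡n∸o (k * c) (W n) (Z n))))

      eventually-returns : ∃ λ T → ∀ n → Returns (n + T)
      eventually-returns = let n , eq = Z-returns in
        time n , returns-both (time n) (returns-time n) (trans (Z-suc n) eq)

  double-∸ : ∀ {i j} → i ≤ j → (j ∸ i) * 2 + i * 2 ≡ j * 2
  double-∸ {i} {j} i≤j = trans (sym (*-distribʳ-+ 2 (j ∸ i) i)) (cong (_* 2) (m∸n+n≡m i≤j))

  X-double-≤ : ∀ {i j} → i ≤ j → X (i * 2) ≤ X (j * 2)
  X-double-≤ {i} {j} i≤j = subst (λ s → X (i * 2) ≤ X s) (double-∸ i≤j) (X-mono-+ ((j ∸ i) * 2) (i * 2))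

  -- Among the `c + 1` values of `X` at times 0, 2, ..., `2c`, two agree modulo `c`; `q` is the
  -- difference of their indices.
  ∃-returns : ∃ λ q → ∃₂ λ k t → 1 ≤ q × q ≤ c × Returns q k t
  ∃-returns
    with i , j , i<j , eq ← Fin.pigeonhole (n<1+n c) (λ i → fromℕ< (m%n<n (X (toℕ i * 2)) c))
    with k , Xj≡ ← %-≡⇒∃* c (X-double-≤ (<⇒≤ i<j)) (Fin.fromℕ<-injective _ _ _ _ eq) =
    toℕ j ∸ toℕ i , k , toℕ i * 2 , m<n⇒0<n∸m i<j ,
    ≤-trans (m∸n≤m (toℕ j) (toℕ i)) (s≤s⁻¹ (Fin.toℕ<n j)) ,
    trans (cong X (double-∸ (<⇒≤ i<j))) Xj≡

  common-return : ∃ λ q → ∃₂ λ k T → 1 ≤ q × q ≤ c ×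
    (∀ t → T ≤ t → X (q * 2 + t) ≡ X t + k * c × Y (q * 2 + t) ≡ Y t + k * d)
  common-return with q , k , t₀ , 1≤q , q≤c , ret ← ∃-returns
                with T , rets ← eventually-returns q k ret = q , k , suc T , 1≤q , q≤c , both
    where
    rets′ : ∀ t → T ≤ t → Returns q k t
    rets′ t T≤t = subst (Returns q k) (m∸n+n≡m T≤t) (rets (t ∸ T))
    both : ∀ t → suc T ≤ t → X (q * 2 + t) ≡ X t + k * c × Y (q * 2 + t) ≡ Y t + k * d
    -- `Y` at `suc t` is computed from `X` at `t`, so its returns begin one step later; hence the
    -- threshold `suc T`.
    both (suc t) (s≤s T≤t) = rets′ (suc t) (m≤n⇒m≤1+n T≤t) , returns-Y q k (rets′ t T≤t)

-- Sizes of the two sides and integer quotients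

count-left : ∀ a b → Σᶠ {a + b} (λ w → ind (side a w)) ≡ a
count-left zero    b = trans (Σᶠ-const b 0) (*-zeroʳ b)
count-left (suc a) b = trans (Σᶠ-suc {a + b} (λ w → ind (side (suc a) w))) (cong suc (count-left a b))

count-right : ∀ a b → Σᶠ {a + b} (λ w → ind (not (side a w))) ≡ b
count-right zero    b = trans (Σᶠ-const b 1) (*-identityʳ b)
count-right (suc a) b = trans (Σᶠ-suc {a + b} (λ w → ind (not (side (suc a) w)))) (count-right a b)

xor-true : ∀ {x y} → (x xor y) ≡ true → y ≡ not x
xor-true {true}  {false} _ = refl
xor-true {false} {true}  _ = refl

xor-not : ∀ x → (x xor not x) ≡ true
xor-not true  = refl
xor-not false = refl

[m+kn]/n≡k : ∀ {m} k n .{{_ : NonZero n}} → m < n → (m + k * n) / n ≡ k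
[m+kn]/n≡k {m} k n m<n = trans (+-distrib-/-∣ʳ m (n∣m*n k)) (cong₂ _+_ (m<n⇒m/n≡0 m<n) (m*n/n≡m k n))

[m+kn]/n≡m/n+k : ∀ m k n .{{_ : NonZero n}} → (m + k * n) / n ≡ m / n + k
[m+kn]/n≡m/n+k m k n = trans (+-distrib-/-∣ʳ m (n∣m*n k)) (cong (m / n +_) (m*n/n≡m k n))

-- Below `n + n` the quotient of `m` by `n` is 0 or 1, which is the firing indicator of a vertex
-- with `m` chips and degree `n`.
[m+kn]/n≡[n≤ᵇm]+k : ∀ {m} k n .{{_ : NonZero n}} → m < n + n →
                     (m + k * n) / n ≡ ind (n ≤ᵇ m) + k
[m+kn]/n≡[n≤ᵇm]+k {m} k n m<2n with n ≤? m
... | no  n≰m rewrite >⇒≤ᵇ≡false (≰⇒> n≰m) = [m+kn]/n≡k k n (≰⇒> n≰m)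
... | yes n≤m rewrite ≤⇒≤ᵇ≡true n≤m = trans (cong (_/ n) (begin
  m + k * n              ≡⟨ cong (_+ k * n) (m∸n+n≡m n≤m) ⟨
  m ∸ n + n + k * n      ≡⟨ +-assoc (m ∸ n) n _ ⟩
  m ∸ n + suc k * n      ∎))
  ([m+kn]/n≡k (suc k) n (+-cancelʳ-< n _ _ (subst (_< n + n) (sym (m∸n+n≡m n≤m)) m<2n)))
  where open ≡-Reasoning

-- The game on a complete bipartite graph

module Bipartite (a b : ℕ) .{{_ : NonZero a}} .{{_ : NonZero b}} where

  𝐊 : Graph (a + b)
  𝐊 = K a b

  opposite : Bool → Fin (a + b) → ℕ
  opposite s w = ind (s xor side a w)

  -- The common degree on side `s`, where `true` is the left side. As a sum, `D (side a v)` is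
  -- `deg 𝐊 v` by computation.
  D : Bool → ℕ
  D s = Σᶠ (opposite s)

  D≡ : ∀ s → D s ≡ (if s then b else a)
  D≡ true  = count-right a b
  D≡ false = count-left a b

  D-nonZero : ∀ s → NonZero (D s)
  D-nonZero true  = subst NonZero (sym (D≡ true)) (>-nonZero (>-nonZero⁻¹ b))
  D-nonZero false = subst NonZero (sym (D≡ false)) (>-nonZero (>-nonZero⁻¹ a))

  infixl 7 _÷_
  _÷_ : ℕ → Bool → ℕ
  x ÷ s = (x / D s) ⦃ D-nonZero s ⦄

  received : Bool → Position (a + b) → ℕ
  received s σ = Σᶠ λ w → ind ((s xor side a w) ∧ fires 𝐊 σ w)

  Confined : Position (a + b) → Set
  Confined σ = ∀ v → σ v < deg 𝐊 v + deg 𝐊 v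

  -- Cumulative firings in a confined game

  module ConfinedGame (σ : Position (a + b)) (confined : Confined σ) where

    fired : ℕ → Fin (a + b) → ℕ
    fired zero    v = 0
    fired (suc t) v = ind (fires 𝐊 (U^ 𝐊 t σ) v) + fired t v

    -- All vertices on side `s` have the same neighbours, so each of them has received this many
    -- chips in the first `t` steps.
    total : Bool → ℕ → ℕ
    total s t = Σᶠ λ w → opposite s w * fired t w

    total-suc : ∀ s t → total s (suc t) ≡ received s (U^ 𝐊 t σ) + total s t
    total-suc s t = trans
      (Σᶠ-cong λ w → trans (*-distribˡ-+ (opposite s w) _ (fired t w))
                           (cong (_+ opposite s w * fired t w) (sym (ind-∧ (s xor side a w) _))))
      (Σᶠ-+ (λ w → ind ((s xor side a w) ∧ fires 𝐊 (U^ 𝐊 t σ) w)) (λ w → opposite s w * fired t w))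

    conservation : ∀ t v → U^ 𝐊 t σ v + fired t v * deg 𝐊 v ≡ σ v + total (side a v) t
    conservation zero    v = cong (σ v +_) (sym (trans (Σᶠ-cong λ w → *-zeroʳ (opposite (side a v) w))
                                                       (trans (Σᶠ-const (a + b) 0) (*-zeroʳ (a + b)))))
    conservation (suc t) v = begin
      U 𝐊 τ v + (f + fired t v) * deg 𝐊 v           ≡⟨ expand (U 𝐊 τ v) f (fired t v) (deg 𝐊 v) ⟩
      U 𝐊 τ v + f * deg 𝐊 v + fired t v * deg 𝐊 v   ≡⟨ cong (_+ fired t v * deg 𝐊 v) (U-conservation 𝐊 τ v) ⟩
      τ v + Φ 𝐊 τ v + fired t v * deg 𝐊 v           ≡⟨ swap (τ v) (Φ 𝐊 τ v) _ ⟩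
      τ v + fired t v * deg 𝐊 v + Φ 𝐊 τ v           ≡⟨ cong (_+ Φ 𝐊 τ v) (conservation t v) ⟩
      σ v + total (side a v) t + Φ 𝐊 τ v            ≡⟨ regroup (σ v) (total (side a v) t) (Φ 𝐊 τ v) ⟩
      σ v + (Φ 𝐊 τ v + total (side a v) t)          ≡⟨ cong (σ v +_) (total-suc (side a v) t) ⟨
      σ v + total (side a v) (suc t)                ∎
      where
      open ≡-Reasoning
      τ = U^ 𝐊 t σ
      f = ind (fires 𝐊 τ v)
      expand : ∀ x f u d → x + (f + u) * d ≡ x + f * d + u * d
      expand = solve-∀
      swap : ∀ x y z → x + y + z ≡ x + z + y
      swap = solve-∀
      regroup : ∀ x y z → x + y + z ≡ x + (z + y)
      regroup = solve-∀

    -- Confinement means that no vertex has an unused firing left over, so the number of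
    -- firings is the integer part of chips over degree.
    fired-suc : ∀ t v → fired (suc t) v ≡ (σ v + total (side a v) t) ÷ side a v
    fired-suc t v = sym (trans (cong (_÷ side a v) (sym (conservation t v)))
      ([m+kn]/n≡[n≤ᵇm]+k (fired t v) (D (side a v)) ⦃ D-nonZero (side a v) ⦄ (confined-at-U^ 𝐊 t σ v (confined v))))

    -- The next value of `total s` when each vertex on the other side has received `x` chips.
    F : Bool → ℕ → ℕ
    F s x = Σᶠ λ w → opposite s w * ((σ w + x) ÷ side a w)

    on-opposite : ∀ s w {x y} → (side a w ≡ not s → x ≡ y) → opposite s w * x ≡ opposite s w * y
    on-opposite s w x≡y with s xor side a w in eq
    ... | true  = cong (1 *_) (x≡y (xor-true eq))
    ... | false = refl

    total-step : ∀ s t → total s (suc t) ≡ F s (total (not s) t)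
    total-step s t = Σᶠ-cong λ w → on-opposite s w λ eq →
      trans (fired-suc t w) (cong (λ s′ → (σ w + total s′ t) ÷ side a w) eq)

    F-mono : ∀ s {x y} → x ≤ y → F s x ≤ F s y
    F-mono s x≤y = Σᶠ-mono-≤ λ w →
      *-monoʳ-≤ (opposite s w) (/-monoˡ-≤ (D (side a w)) ⦃ D-nonZero (side a w) ⦄ (+-monoʳ-≤ (σ w) x≤y))

    -- With `D (not s)` more chips, a full degree, each vertex opposite to `s` fires exactly once
    -- more, and there are `D s` such vertices.
    F-shift : ∀ s x → F s (x + D (not s)) ≡ F s x + D s
    F-shift s x = trans
      (Σᶠ-cong λ w → trans
        (on-opposite s w λ eq → trans
          (cong (_÷ side a w) (trans (sym (+-assoc (σ w) x _))
            (cong (σ w + x +_) (trans (cong D (sym eq)) (sym (*-identityˡ _))))))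
          ([m+kn]/n≡m/n+k (σ w + x) 1 (D (side a w)) ⦃ D-nonZero (side a w) ⦄))
        (trans (*-distribˡ-+ (opposite s w) _ 1)
               (cong (opposite s w * ((σ w + x) ÷ side a w) +_) (*-identityʳ (opposite s w)))))
      (Σᶠ-+ (λ w → opposite s w * ((σ w + x) ÷ side a w)) (opposite s))

    Returns-total : ℕ → ℕ → ℕ → Bool → Set
    Returns-total q k T s = ∀ t → T ≤ t → total s (q * 2 + t) ≡ total s t + k * D s

    -- The pigeonhole argument runs modulo `D s`, so the choice of `s` sets the bound on `q`.
    total-returns : ∀ s → ∃ λ q → ∃₂ λ k T → 1 ≤ q × q ≤ D s × (∀ s′ → Returns-total q k T s′)
    total-returns s = repack s (Interleaved.common-return {F s} {F (not s)} {D s} {D (not s)} ⦃ D-nonZero s ⦄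
        (F-mono s) (F-shift s) (F-mono (not s))
        (λ x → subst (λ s′ → F (not s) (x + D s′) ≡ F (not s) x + D (not s)) (not-involutive s)
                     (F-shift (not s) x))
        {total s} {total (not s)}
        (total-step s)
        (λ t → subst (λ s′ → total (not s) (suc t) ≡ F (not s) (total s′ t)) (not-involutive s)
                     (total-step (not s) t))
        (λ t → subst (total s t ≤_) (sym (total-suc s t)) (m≤n+m _ _)))
      where
      repack : ∀ s → (∃ λ q → ∃₂ λ k T → 1 ≤ q × q ≤ D s ×
        (∀ t → T ≤ t → total s (q * 2 + t) ≡ total s t + k * D s
                     × total (not s) (q * 2 + t) ≡ total (not s) t + k * D (not s))) →
        ∃ λ q → ∃₂ λ k T → 1 ≤ q × q ≤ D s × (∀ s′ → Returns-total q k T s′)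
      repack true  (q , k , T , 1≤q , q≤D , ret) = q , k , T , 1≤q , q≤D , λ
        { true  t T≤t → proj₁ (ret t T≤t) ; false t T≤t → proj₂ (ret t T≤t) }
      repack false (q , k , T , 1≤q , q≤D , ret) = q , k , T , 1≤q , q≤D , λ
        { true  t T≤t → proj₂ (ret t T≤t) ; false t T≤t → proj₁ (ret t T≤t) }

    -- Over `q * 2` steps every vertex receives `k` times its degree and fires `k` times, so its
    -- chips balance.
    eventual-period : ∀ s → ∃ λ q → 1 ≤ q × q ≤ D s × EventuallyPeriodic 𝐊 σ (q * 2)
    eventual-period s = repack (total-returns s)
      where
      recur : ∀ q k T → (∀ s → Returns-total q k T s) →
              ∀ t → T ≤ t → ∀ v → U^ 𝐊 (suc t) σ v ≡ U^ 𝐊 (suc t + q * 2) σ v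
      recur q k T ret t T≤t v = +-cancelʳ-≡ (fired (suc t) v * d + k * d) _ _ (begin
        x + (fired (suc t) v * d + k * d)          ≡⟨ +-assoc x _ _ ⟨
        x + fired (suc t) v * d + k * d            ≡⟨ cong (_+ k * d) (conservation (suc t) v) ⟩
        σ v + total (side a v) (suc t) + k * d     ≡⟨ +-assoc (σ v) _ _ ⟩
        σ v + (total (side a v) (suc t) + k * d)   ≡⟨ cong (σ v +_) (ret (side a v) (suc t) (m≤n⇒m≤1+n T≤t)) ⟨
        σ v + total (side a v) (q * 2 + suc t)     ≡⟨ cong (λ r → σ v + total (side a v) r) (+-comm (q * 2) (suc t)) ⟩
        σ v + total (side a v) (suc t + q * 2)     ≡⟨ conservation (suc t + q * 2) v ⟨
        y + fired (suc t + q * 2) v * d            ≡⟨ cong (λ u → y + u * d) fired-later ⟩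
        y + (fired (suc t) v + k) * d              ≡⟨ cong (y +_) (*-distribʳ-+ d (fired (suc t) v) k) ⟩
        y + (fired (suc t) v * d + k * d)          ∎)
        where
        open ≡-Reasoning
        d = D (side a v)
        x = U^ 𝐊 (suc t) σ v
        y = U^ 𝐊 (suc t + q * 2) σ v
        fired-later : fired (suc t + q * 2) v ≡ fired (suc t) v + k
        fired-later = begin
          fired (suc (t + q * 2)) v
            ≡⟨ fired-suc (t + q * 2) v ⟩
          (σ v + total (side a v) (t + q * 2)) ÷ side a v
            ≡⟨ cong (λ r → (σ v + total (side a v) r) ÷ side a v) (+-comm t (q * 2)) ⟩
          (σ v + total (side a v) (q * 2 + t)) ÷ side a v
            ≡⟨ cong (λ r → (σ v + r) ÷ side a v) (ret (side a v) t T≤t) ⟩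
          (σ v + (total (side a v) t + k * d)) ÷ side a v
            ≡⟨ cong (_÷ side a v) (+-assoc (σ v) _ _) ⟨
          (σ v + total (side a v) t + k * d) ÷ side a v
            ≡⟨ [m+kn]/n≡m/n+k (σ v + total (side a v) t) k d ⦃ D-nonZero (side a v) ⦄ ⟩
          (σ v + total (side a v) t) ÷ side a v + k
            ≡⟨ cong (_+ k) (fired-suc t v) ⟨
          fired (suc t) v + k                              ∎
      repack : (∃ λ q → ∃₂ λ k T → 1 ≤ q × q ≤ D s × (∀ s′ → Returns-total q k T s′)) →
               ∃ λ q → 1 ≤ q × q ≤ D s × EventuallyPeriodic 𝐊 σ (q * 2)
      repack (q , k , T , 1≤q , q≤D , ret) =
        -- The firings up to `suc t` are read off from the totals at `t`, which costs one step of
        -- the threshold.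
        q , 1≤q , q≤D , suc T , λ { (suc t) (s≤s T≤t) v → recur q k T ret t T≤t v }

  index : Fin (a + b) → ℕ
  index v = if side a v then toℕ v else toℕ v ∸ a

  index-on : ∀ {s} v → side a v ≡ s → index v ≡ (if s then toℕ v else toℕ v ∸ a)
  index-on v = cong (λ s → if s then toℕ v else toℕ v ∸ a)

  vertex-at : ∀ s k → k < a ⊓ b → ∃ λ (v : Fin (a + b)) → side a v ≡ s × index v ≡ k
  vertex-at true k k<a⊓b = v , left , trans (index-on v left) toℕ≡k
    where
    k<a = m<n⊓o⇒m<n a b k<a⊓b
    v = fromℕ< k<a ↑ˡ b
    toℕ≡k : toℕ v ≡ k
    toℕ≡k = trans (Fin.toℕ-↑ˡ (fromℕ< k<a) b) (Fin.toℕ-fromℕ< k<a)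
    left : side a v ≡ true
    left = trans (cong (_<ᵇ a) toℕ≡k) (≤⇒≤ᵇ≡true k<a)
  vertex-at false k k<a⊓b = v , right , trans (index-on v right) (trans (cong (_∸ a) toℕ≡a+k) (m+n∸m≡n a k))
    where
    k<b = m<n⊓o⇒m<o a b k<a⊓b
    v = a ↑ʳ fromℕ< k<b
    toℕ≡a+k : toℕ v ≡ a + k
    toℕ≡a+k = trans (Fin.toℕ-↑ʳ a (fromℕ< k<b)) (cong (a +_) (Fin.toℕ-fromℕ< k<b))
    right : side a v ≡ false
    right = trans (cong (_<ᵇ a) toℕ≡a+k) (>⇒≤ᵇ≡false (s≤s (m≤m+n a k)))

  0<a⊓b : 0 < a ⊓ b
  0<a⊓b = ⊓-pres-m< (>-nonZero⁻¹ a) (>-nonZero⁻¹ b)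

  -- A degree is the size of the opposite side: for `a ≤ b` the right side, `false`, has the smaller
  -- degree `a`.
  smaller-side : ∃ λ s → D s ≤ a ⊓ b
  smaller-side with ≤-total a b
  ... | inj₁ a≤b = false , ≤-reflexive (trans (D≡ false) (sym (m≤n⇒m⊓n≡m a≤b)))
  ... | inj₂ b≤a = true  , ≤-reflexive (trans (D≡ true) (sym (m≥n⇒m⊓n≡n b≤a)))

  unconfined⇒fixed : ∀ {σ p v} → 1 ≤ p → Periodic 𝐊 σ p → ¬ (σ v < deg 𝐊 v + deg 𝐊 v) → Periodic 𝐊 σ 1
  unconfined⇒fixed {σ} {p} {v} 1≤p per unconfined w = always-fires⇒fixed 𝐊 {p} 1≤p per everywhere
    where
    spread : ∀ {x y} → side a y ≡ not (side a x) → AlwaysFires 𝐊 σ x → AlwaysFires 𝐊 σ y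
    spread {x} y-opposite = always-fires-spreads 𝐊 {p} 1≤p per
      (trans (cong (side a x xor_) y-opposite) (xor-not (side a x)))
    always : AlwaysFires 𝐊 σ v
    always = unconfined⇒always-fires 𝐊 {p} 1≤p per unconfined
    everywhere : AlwaysFires 𝐊 σ w
    everywhere with side a w Bool.≟ side a v
    ... | no  different = spread (¬-not different) always
    -- Vertices on the same side are not adjacent, so the property passes through a vertex `u` on
    -- the other side.
    ... | yes same      = let u , u-side , _ = vertex-at (not (side a v)) 0 0<a⊓b in
      spread (trans same (trans (sym (not-involutive (side a v))) (cong not (sym u-side))))
             (spread u-side always)

  period-∣-2q : ∀ {σ p} → IsPeriod 𝐊 σ p → ∃ λ q → 1 ≤ q × q ≤ a ⊓ b × p ∣ q * 2
  period-∣-2q {σ} {p} isPeriod@(1≤p , ep@(T , _) , _)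
    with Fin.all? (λ v → U^ 𝐊 T σ v <? deg 𝐊 v + deg 𝐊 v) | smaller-side
  ... | yes confined | s , Ds≤ =
    let q , 1≤q , q≤D , ep₂ = ConfinedGame.eventual-period (U^ 𝐊 T σ) confined s
    in q , 1≤q , ≤-trans q≤D Ds≤ , period-∣ 𝐊 isPeriod (shifted-eventually 𝐊 T ep₂)
  ... | no ¬confined | _ =
    let v , unconfined = Fin.¬∀⟶∃¬ (a + b) _ (λ v → U^ 𝐊 T σ v <? deg 𝐊 v + deg 𝐊 v) ¬confined
        fixed = unconfined⇒fixed {p = p} 1≤p (eventually⇒shifted-periodic 𝐊 ep) unconfined
    in 1 , ≤-refl , 0<a⊓b ,
       ∣-trans (period-∣ 𝐊 isPeriod (shifted-eventually 𝐊 T (Periodic⇒EventuallyPeriodic 𝐊 {p = 1} fixed))) (1∣ 2)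

  -- Schedules on the complete bipartite graph

  module _ {m : ℕ} (m<a⊓b : m < a ⊓ b) where

    -- Truncation at `m` puts all surplus vertices in the top level; every level from 0 to `m`
    -- occurs on both sides because `m < a ⊓ b`.
    level : Fin (a + b) → ℕ
    level v = index v ⊓ m

    vertex-at-level : ∀ s k → k ≤ m → ∃ λ v → side a v ≡ s × level v ≡ k
    vertex-at-level s k k≤m = let v , v-side , eq = vertex-at s k (≤-<-trans k≤m m<a⊓b) in
      v , v-side , trans (cong (_⊓ m) eq) (m≤n⇒m⊓n≡m k≤m)

    level≤m : ∀ v → level v ≤ m
    level≤m v = m⊓n≤n (index v) m

    neighbour-at-level : ∀ v {k} → k ≤ m → ∃ λ w → adj 𝐊 v w ≡ true × side a w ≡ not (side a v) × level w ≡ k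
    neighbour-at-level v k≤m = let w , w-side , eq = vertex-at-level (not (side a v)) _ k≤m in
      w , trans (cong (side a v xor_) w-side) (xor-not (side a v)) , w-side , eq

    simultaneous : Rotation.Schedule 𝐊 m level
    simultaneous = record
      { bounded     = level≤m
      ; predecessor = λ v → let w , vw , _ , eq = neighbour-at-level v (rotate-≤ (level≤m v)) in w , vw , eq
      }

    period-1+m : ∃ λ σ → IsPeriod 𝐊 σ (suc m)
    period-1+m = let v , _ , eq = vertex-at-level true 0 z≤n in
      _ , Rotation.position-period 𝐊 m simultaneous v eq

    class : Bool → ℕ → ℕ
    class s k = ind (not s) + k * 2

    alternating : Rotation.Schedule 𝐊 (suc (m * 2)) (λ v → class (side a v) (level v))
    alternating = record
      { bounded     = λ v → class-≤ (side a v) (level≤m v)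
      ; predecessor = λ v →
          let k , k≤m , eq = before (side a v) (level v) (level≤m v)
              w , vw , w-side , w-level = neighbour-at-level v k≤m
          in w , vw , trans (cong₂ class w-side w-level) eq
      }
      where
      class-≤ : ∀ s {k} → k ≤ m → class s k ≤ suc (m * 2)
      class-≤ true  k≤m = m≤n⇒m≤1+n (*-monoˡ-≤ 2 k≤m)
      class-≤ false k≤m = s≤s (*-monoˡ-≤ 2 k≤m)
      -- Left classes are `2k` and right classes `2k + 1`. Going down by one keeps the level when
      -- moving from right to left and lowers it from left to right, where left class 0 wraps to
      -- right level `m`.
      before : ∀ s k → k ≤ m → ∃ λ k′ → k′ ≤ m × class (not s) k′ ≡ rotate (suc (m * 2)) (class s k)
      before true  zero    _   = m , ≤-refl , refl
      before true  (suc k) k<m = k , <⇒≤ k<m , refl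
      before false k       k≤m = k , k≤m , refl

    period-2[1+m] : ∃ λ σ → IsPeriod 𝐊 σ (suc m * 2)
    period-2[1+m] = let v , v-side , eq = vertex-at-level true 0 z≤n in
      -- The top class `suc (m * 2)` gives a period that computes to `suc m * 2`.
      _ , Rotation.position-period 𝐊 (suc (m * 2)) alternating v (cong₂ class v-side eq)

-- In `q * 2 ≡ k * p` the prime 2 divides `k` or `p`. Halving `k` gives `p ∣ q`; halving `p` gives
-- the second alternative.
∣-double : ∀ {p q} → p ∣ q * 2 → p ∣ q ⊎ ∃ λ i → p ≡ 2 * i × i ∣ q
∣-double {p} {q} (divides k eq) with euclidsLemma k p prime[2] (divides q (sym eq))
... | inj₁ (divides k′ refl) = inj₁ (divides k′ (*-cancelʳ-≡ q (k′ * p) 2 (trans eq (swap k′ p))))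
  where
  swap : ∀ x y → x * 2 * y ≡ x * y * 2
  swap = solve-∀
... | inj₂ (divides i refl) = inj₂ (i , *-comm i 2 ,
    divides k (*-cancelʳ-≡ q (k * i) 2 (trans eq (sym (*-assoc k i 2)))))

theorem3p8 : (a b : ℕ) → 1 ≤ a → 1 ≤ b → (p : ℕ) →
    (Σ (Position (a + b)) λ σ → IsPeriod (K a b) σ p) ⇔
    ((1 ≤ p × p ≤ a ⊓ b) ⊎ (Σ ℕ λ i → 1 ≤ i × i ≤ a ⊓ b × p ≡ 2 * i))
theorem3p8 a b 1≤a 1≤b p = mk⇔ necessary sufficient
  where
  open Bipartite a b ⦃ >-nonZero 1≤a ⦄ ⦃ >-nonZero 1≤b ⦄

  necessary : (∃ λ σ → IsPeriod (K a b) σ p) → (1 ≤ p × p ≤ a ⊓ b) ⊎ (∃ λ i → 1 ≤ i × i ≤ a ⊓ b × p ≡ 2 * i)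
  necessary (σ , isPeriod@(1≤p , _)) with period-∣-2q isPeriod
  -- Exposing the successor provides the nonzero instance with which `∣⇒≤` turns divisibility into a
  -- bound.
  ... | suc q , _ , q≤ , p∣2q with ∣-double p∣2q
  ...   | inj₁ p∣q                   = inj₁ (1≤p , ≤-trans (∣⇒≤ p∣q) q≤)
  ...   | inj₂ (zero , refl , _)     = contradiction 1≤p λ ()
  ...   | inj₂ (suc i , p≡2i , i∣q)  = inj₂ (suc i , s≤s z≤n , ≤-trans (∣⇒≤ i∣q) q≤ , p≡2i)

  sufficient : (1 ≤ p × p ≤ a ⊓ b) ⊎ (∃ λ i → 1 ≤ i × i ≤ a ⊓ b × p ≡ 2 * i) → ∃ λ σ → IsPeriod (K a b) σ p
  sufficient (inj₁ (s≤s _ , p≤)) = period-1+m p≤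
  sufficient (inj₂ (suc m , _ , i≤ , refl)) =
    subst (λ p → ∃ λ σ → IsPeriod (K a b) σ p) (*-comm (suc m) 2) (period-2[1+m] i≤)
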